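{- Let $G$ be a cubic graph of order $n$ and let $\mathcal{C}$ be a $4$-total coloring of $G$ with color set $\{1,2,3,4\}$. For each $i \in \{1,2,3,4\}$, let $S_i$ be the set of vertices of color $i$, let $M_i$ be the set of edges of color $i$, and let $c_i = S_i \cup M_i$ be the color class of color $i$. Then: (i) $(S_1,S_2,S_3,S_4)$ is a partition of $V(G)$ into (possibly empty) independent sets; (ii) for each $i$, the set $M_i$ is a perfect matching of $G - S_i$; (iii) $(M_1,M_2,M_3,M_4)$ is a partition of $E(G)$; (iv) for each $i$, the cardinality $|S_i|$ is even and $|c_i| = (n + |S_i|)/2$. Conversely, if $G$ is a cubic graph, $(S_1,S_2,S_3,S_4)$ is a partition of $V(G)$ into (possibly empty) independent sets and $(M_1,M_2,M_3,M_4)$ is a partition of $E(G)$ such that each $M_i$ is a perfect matching of $G - S_i$, then assigning color $i$ to the vertices of $S_i$ and to the edges of $M_i$ yields a $4$-total coloring of $G$.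
   Context: All graphs are finite, simple and cubic ($3$-regular), not necessarily connected. The order of a graph is its number of vertices. A $4$-total coloring of $G$ assigns one of the four colors $1,2,3,4$ to each vertex and each edge of $G$ so that adjacent vertices receive distinct colors, adjacent edges (edges sharing an endpoint) receive distinct colors, and every vertex and edge that are incident receive distinct colors. For $S \subseteq V(G)$, $G - S$ denotes the subgraph induced by $V(G)\setminus S$. The color class $c_i$ is the set of all elements (vertices and edges) of color $i$. -}

module Defs where

open import Data.Fin.Base using (Fin)
open import Data.Fin.Properties using (_≟_)
open import Data.Fin.Subset using (Subset; _∈_; _⊆_; ∁; _∩_; ∣_∣; Empty)
open import Data.Fin.Subset.Properties using (_∈?_; _⊆?_)
open import Data.Nat.Base using (ℕ; _+_)
open import Data.Product.Base using (∃-syntax; _×_)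
open import Data.Vec.Base using (tabulate; _++_)
open import Data.Vec.Properties using ([]=⇒lookup; lookup∘tabulate)
open import Function.Definitions using (Injective)
open import Relation.Binary.PropositionalEquality using (_≡_; _≢_; sym; trans)
open import Relation.Nullary using (¬_; yes; no; does)
open import Relation.Unary using (Pred; Decidable)
open import Level using (0ℓ)

subset : ∀ {n} {P : Pred (Fin n) 0ℓ} → Decidable P → Subset n
subset P? = tabulate (λ x → does (P? x))

∈-subset⁻ : ∀ {n} {P : Pred (Fin n) 0ℓ} (P? : Decidable P) {x : Fin n} →
            x ∈ subset P? → P x
∈-subset⁻ P? {x} x∈
  with P? x | trans (sym (lookup∘tabulate (λ y → does (P? y)) x)) ([]=⇒lookup x∈)
... | yes p | _ = p
... | no _  | ()

-- Parts may be empty.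
record IsPartition {k n : ℕ} (P : Fin k → Subset n) : Set where
  field
    covers   : ∀ x → ∃[ i ] x ∈ P i
    disjoint : ∀ {i j} → i ≢ j → Empty (P i ∩ P j)

-- A finite simple graph: the edge set is a set of 2-element vertex sets,
-- enumerated without repetition by Fin size.  Loops are excluded by
-- ends-card and parallel edges by ends-injective.
record Graph : Set where
  field
    order          : ℕ
    size           : ℕ
    ends           : Fin size → Subset order
    ends-card      : ∀ e → ∣ ends e ∣ ≡ 2
    ends-injective : Injective _≡_ _≡_ ends

  Vertex : Set
  Vertex = Fin order

  Edge : Set
  Edge = Fin size

  VertexSet : Set
  VertexSet = Subset order

  EdgeSet : Set
  EdgeSet = Subset size

  Incident : Vertex → Edge → Set
  Incident v e = v ∈ ends e

  AdjacentVertices : Vertex → Vertex → Set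
  AdjacentVertices u v = u ≢ v × ∃[ e ] (Incident u e × Incident v e)

  AdjacentEdges : Edge → Edge → Set
  AdjacentEdges e f = e ≢ f × ∃[ v ] (Incident v e × Incident v f)

  degree : Vertex → ℕ
  degree v = ∣ subset (λ e → v ∈? ends e) ∣

  Independent : VertexSet → Set
  Independent S = ∀ {u v} → u ∈ S → v ∈ S → ¬ AdjacentVertices u v

open Graph public

Cubic : Graph → Set
Cubic G = ∀ v → degree G v ≡ 3

record Subgraph (G : Graph) : Set where
  field
    vertices : VertexSet G
    edges    : EdgeSet G
    closed   : ∀ {e} → e ∈ edges → ends G e ⊆ vertices

open Subgraph public

infixl 6 _-ᵥ_

-- G - S, the subgraph induced by the complement of S.
_-ᵥ_ : (G : Graph) → VertexSet G → Subgraph G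
G -ᵥ S = record
  { vertices = ∁ S
  ; edges    = subset inside?
  ; closed   = ∈-subset⁻ inside?
  }
  where
  inside? : Decidable (λ e → ends G e ⊆ ∁ S)
  inside? e = ends G e ⊆? ∁ S

record IsPerfectMatching {G : Graph} (H : Subgraph G) (M : EdgeSet G) : Set where
  field
    inSubgraph  : M ⊆ edges H
    nonadjacent : ∀ {e f} → e ∈ M → f ∈ M → ¬ AdjacentEdges G e f
    saturates   : ∀ {v} → v ∈ vertices H → ∃[ e ] (e ∈ M × Incident G v e)

-- An arbitrary assignment of k colors to vertices and edges; properness is
-- the separate predicate IsTotalColoring.
record Assignment (k : ℕ) (G : Graph) : Set where
  field
    vcolor : Vertex G → Fin k
    ecolor : Edge G → Fin k

  vertexClass : Fin k → VertexSet G
  vertexClass i = subset (λ v → vcolor v ≟ i)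

  edgeClass : Fin k → EdgeSet G
  edgeClass i = subset (λ e → ecolor e ≟ i)

  -- Vertices and edges together are indexed by Fin (order + size), vertices
  -- first, so appending is the union of the vertex and edge classes.
  colorClass : Fin k → Subset (order G + size G)
  colorClass i = vertexClass i ++ edgeClass i

open Assignment public

record IsTotalColoring {k : ℕ} {G : Graph} (c : Assignment k G) : Set where
  field
    vertex-vertex : ∀ {u v} → AdjacentVertices G u v → vcolor c u ≢ vcolor c v
    edge-edge     : ∀ {e f} → AdjacentEdges G e f → ecolor c e ≢ ecolor c f
    vertex-edge   : ∀ {v e} → Incident G v e → vcolor c v ≢ ecolor c e

-- c gives color i to the vertices of S i and to the edges of M i.
record Assigns {k : ℕ} {G : Graph} (c : Assignment k G)
               (S : Fin k → VertexSet G) (M : Fin k → EdgeSet G) : Set where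
  field
    onVertices : ∀ {i v} → v ∈ S i → vcolor c v ≡ i
    onEdges    : ∀ {i e} → e ∈ M i → ecolor c e ≡ i

{-# OPTIONS --safe #-}
-- In a cubic graph the three edges at a vertex v have distinct colors, all
-- different from that of v, so all four colors occur at v; hence M i saturates
-- G - S i.  Counting incidences then gives 2 |M i| = n - |S i| and 3 n = 2 |E|,
-- so n is even and the two assertions on |S i| and |c i| follow.
module Submission where

open import Defs
open import Data.Bool.Base using (Bool; if_then_else_)
open import Data.Fin.Base using (Fin; zero; suc)
open import Data.Fin.Properties using (_≟_; any?; suc-injective)
open import Data.Fin.Subset
  using (Subset; inside; outside; ⊤; ∁; _∈_; _⊆_; _-_; ⁅_⁆; Empty; ∣_∣)
open import Data.Fin.Subset.Properties
open import Data.Nat.Base using (ℕ; zero; suc; z≤n; _+_; _*_; _≤_)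
open import Data.Nat.Divisibility using (_∣_; m∣m*n; ∣m+n∣m⇒∣n)
open import Data.Nat.Properties
  using (+-*-semiring; +-assoc; +-comm; *-comm;
         *-distribˡ-+; m∸n+n≡m; ≤-<-trans; ≤⇒≯; ≤-reflexive; <-≤-trans)
open import Data.Product.Base using (_×_; _,_; ∃-syntax; proj₁; proj₂)
open import Data.Vec.Base using ([]; _∷_; _++_; here; there; lookup)
open import Data.Vec.Functional using (Vector)
open import Data.Vec.Properties using (lookup∘tabulate; lookup⇒[]=; []=⇒lookup)
open import Function.Base using (_∘_; case_of_)
open import Level using (0ℓ)
open import Relation.Binary.PropositionalEquality hiding ([_])
open import Relation.Nullary using (¬_; Dec; yes; no; does; contradiction; decidable-stable)
open import Relation.Nullary.Decidable using (_×-dec_; dec-true)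
open import Relation.Unary using (Pred; Decidable)

open import Algebra.Properties.Semiring.Sum +-*-semiring
  using (sum; sum-cong-≗; ∑-comm; *-distribˡ-sum)

private
  variable
    k m n : ℕ

-- Membership and cardinality of finite subsets.

∈-subset⁺ : {P : Pred (Fin n) 0ℓ} (P? : Decidable P) {x : Fin n} →
            P x → x ∈ subset P?
∈-subset⁺ P? {x} px =
  lookup⇒[]= x _ (trans (lookup∘tabulate (does ∘ P?) x) (dec-true (P? x) px))

∣p++q∣≡∣p∣+∣q∣ : (p : Subset m) (q : Subset n) → ∣ p ++ q ∣ ≡ ∣ p ∣ + ∣ q ∣
∣p++q∣≡∣p∣+∣q∣ []            q = refl
∣p++q∣≡∣p∣+∣q∣ (inside  ∷ p) q = cong suc (∣p++q∣≡∣p∣+∣q∣ p q)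
∣p++q∣≡∣p∣+∣q∣ (outside ∷ p) q = ∣p++q∣≡∣p∣+∣q∣ p q

∣∁p∣+∣p∣≡n : (p : Subset n) → ∣ ∁ p ∣ + ∣ p ∣ ≡ n
∣∁p∣+∣p∣≡n p = trans (cong (_+ ∣ p ∣) (∣∁p∣≡n∸∣p∣ p)) (m∸n+n≡m (∣p∣≤n p))

Empty⇒∣p∣≡0 : {p : Subset n} → Empty p → ∣ p ∣ ≡ 0
Empty⇒∣p∣≡0 {n} empty = trans (cong ∣_∣ (Empty-unique empty)) (∣⊥∣≡0 n)

unique⇒∣p∣≡1 : {p : Subset n} {x : Fin n} → x ∈ p → (∀ {y} → y ∈ p → y ≡ x) → ∣ p ∣ ≡ 1
unique⇒∣p∣≡1 {p = p} {x} x∈p unique =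
  trans (cong ∣_∣ (⊆-antisym p⊆⁅x⁆ ⁅x⁆⊆p)) (∣⁅x⁆∣≡1 x)
  where
  p⊆⁅x⁆ : p ⊆ ⁅ x ⁆
  p⊆⁅x⁆ y∈p = subst (_∈ ⁅ x ⁆) (sym (unique y∈p)) (x∈⁅x⁆ x)

  ⁅x⁆⊆p : ⁅ x ⁆ ⊆ p
  ⁅x⁆⊆p y∈⁅x⁆ = subst (_∈ p) (sym (x∈⁅y⁆⇒x≡y x y∈⁅x⁆)) x∈p

-- Induction on `p`: the image of a first member is removed from `q`, and injectivity keeps the
-- other images inside the smaller set.
injectiveOn⇒∣p∣≤∣q∣ :
  (p : Subset m) (q : Subset n) (f : Fin m → Fin n) →
  (∀ {x} → x ∈ p → f x ∈ q) →
  (∀ {x y} → x ∈ p → y ∈ p → f x ≡ f y → x ≡ y) →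
  ∣ p ∣ ≤ ∣ q ∣
injectiveOn⇒∣p∣≤∣q∣ []            q f maps inj = z≤n
injectiveOn⇒∣p∣≤∣q∣ (outside ∷ p) q f maps inj =
  injectiveOn⇒∣p∣≤∣q∣ p q (f ∘ suc) (maps ∘ there)
    λ x∈ y∈ → suc-injective ∘ inj (there x∈) (there y∈)
injectiveOn⇒∣p∣≤∣q∣ (inside ∷ p)  q f maps inj =
  ≤-<-trans
    (injectiveOn⇒∣p∣≤∣q∣ p (q - f zero) (f ∘ suc)
      (λ x∈ → x∈p∧x≢y⇒x∈p-y (maps (there x∈)) λ eq → suc≢zero (inj (there x∈) here eq))
      (λ x∈ y∈ → suc-injective ∘ inj (there x∈) (there y∈)))
    (x∈p⇒∣p-x∣<∣p∣ (maps here))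
  where
  suc≢zero : ∀ {k} {x : Fin k} → suc x ≢ zero
  suc≢zero ()

-- Indicator sums and double counting.

[_] : Bool → ℕ
[ b ] = if b then 1 else 0

∣p∣≡∑ : (p : Subset n) → ∣ p ∣ ≡ sum (λ x → [ lookup p x ])
∣p∣≡∑ []            = refl
∣p∣≡∑ (inside  ∷ p) = cong suc (∣p∣≡∑ p)
∣p∣≡∑ (outside ∷ p) = ∣p∣≡∑ p

∣subset∣≡∑ : {P : Pred (Fin n) 0ℓ} (P? : Decidable P) →
             ∣ subset P? ∣ ≡ sum (λ x → [ does (P? x) ])
∣subset∣≡∑ P? =
  trans (∣p∣≡∑ (subset P?)) (sum-cong-≗ λ x → cong [_] (lookup∘tabulate (does ∘ P?) x))

-- Both sides count the pairs in `R`: cardinalities become sums of indicators, and the two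
-- summations are exchanged.
double-counting :
  {R : Fin m → Fin n → Set} (R? : ∀ i j → Dec (R i j)) →
  sum (λ i → ∣ subset (R? i) ∣) ≡ sum (λ j → ∣ subset (λ i → R? i j) ∣)
double-counting R? = begin
  sum (λ i → ∣ subset (R? i) ∣)                 ≡⟨ sum-cong-≗ (λ i → ∣subset∣≡∑ (R? i)) ⟩
  sum (λ i → sum (λ j → [ does (R? i j) ]))     ≡⟨ ∑-comm (λ i j → [ does (R? i j) ]) ⟩
  sum (λ j → sum (λ i → [ does (R? i j) ]))     ≡⟨ sum-cong-≗ (λ j → ∣subset∣≡∑ (λ i → R? i j)) ⟨
  sum (λ j → ∣ subset (λ i → R? i j) ∣)         ∎
  where open ≡-Reasoning

sum-const : {f : Vector ℕ n} → (∀ x → f x ≡ k) → sum f ≡ n * k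
sum-const {zero}  f≡k = refl
sum-const {suc n} f≡k = cong₂ _+_ (f≡k zero) (sum-const (f≡k ∘ suc))

-- Partitions.

module _ {P : Fin k → Subset n} (partition : IsPartition P) where
  open IsPartition partition

  part-unique : ∀ {i j x} → x ∈ P i → x ∈ P j → i ≡ j
  part-unique {i} {j} {x} x∈Pᵢ x∈Pⱼ =
    decidable-stable (i ≟ j) λ i≢j → disjoint i≢j (x , x∈p∩q⁺ (x∈Pᵢ , x∈Pⱼ))

fibres-partition : (f : Fin n → Fin k) → IsPartition (λ i → subset (λ x → f x ≟ i))
fibres-partition f = record
  { covers   = λ x → f x , ∈-subset⁺ (λ y → f y ≟ f x) refl
  ; disjoint = λ {i} {j} i≢j (x , x∈) →
      let x∈ᵢ , x∈ⱼ = x∈p∩q⁻ _ _ x∈ in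
      i≢j (trans (sym (∈-subset⁻ (λ y → f y ≟ i) x∈ᵢ)) (∈-subset⁻ (λ y → f y ≟ j) x∈ⱼ))
  }

-- Counting the edges of a matching.

-- Incidences with edges of `M` are counted twice over. An edge of `M` has two ends. A vertex of `H`
-- lies on exactly one edge of `M`, by `saturates` and `nonadjacent`; any other vertex lies on none,
-- because `H` is closed under taking ends.
2*∣perfectMatching∣ : {G : Graph} {H : Subgraph G} {M : EdgeSet G} →
                      IsPerfectMatching H M → 2 * ∣ M ∣ ≡ ∣ vertices H ∣
2*∣perfectMatching∣ {G} {H} {M} matching = begin
  2 * ∣ M ∣                                   ≡⟨ cong (2 *_) (∣p∣≡∑ M) ⟩
  2 * sum (λ e → [ lookup M e ])              ≡⟨ *-distribˡ-sum 2 (λ e → [ lookup M e ]) ⟩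
  sum (λ e → 2 * [ lookup M e ])              ≡⟨ sum-cong-≗ edge-count ⟨
  sum (λ e → ∣ subset (incident? e) ∣)        ≡⟨ double-counting incident? ⟩
  sum (λ v → ∣ subset (λ e → incident? e v) ∣) ≡⟨ sum-cong-≗ vertex-count ⟩
  sum (λ v → [ lookup (vertices H) v ])       ≡⟨ ∣p∣≡∑ (vertices H) ⟨
  ∣ vertices H ∣                              ∎
  where
  open ≡-Reasoning
  open IsPerfectMatching matching

  incident? : ∀ e v → Dec (e ∈ M × Incident G v e)
  incident? e v = (e ∈? M) ×-dec (v ∈? ends G e)

  ∉⇒outside : ∀ {n} {p : Subset n} {x} → ¬ x ∈ p → lookup p x ≡ outside
  ∉⇒outside {p = p} {x} x∉p with lookup p x in eq
  ... | inside  = contradiction (lookup⇒[]= x p eq) x∉p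
  ... | outside = refl

  edge-count : ∀ e → ∣ subset (incident? e) ∣ ≡ 2 * [ lookup M e ]
  edge-count e = case e ∈? M of λ where
    (yes e∈M) → trans
      (cong ∣_∣ (⊆-antisym (proj₂ ∘ ∈-subset⁻ (incident? e))
                           (λ v∈e → ∈-subset⁺ (incident? e) (e∈M , v∈e))))
      (trans (ends-card G e) (cong (λ b → 2 * [ b ]) (sym ([]=⇒lookup e∈M))))
    (no e∉M) → trans
      (Empty⇒∣p∣≡0 λ (v , v∈) → e∉M (proj₁ (∈-subset⁻ (incident? e) v∈)))
      (cong (λ b → 2 * [ b ]) (sym (∉⇒outside e∉M)))

  vertex-count : ∀ v → ∣ subset (λ e → incident? e v) ∣ ≡ [ lookup (vertices H) v ]
  vertex-count v with v ∈? vertices H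
  ... | yes v∈H =
    let e , e∈M , v∈e = saturates v∈H
        unique : ∀ {f} → f ∈ subset (λ e → incident? e v) → f ≡ e
        unique {f} f∈ = let f∈M , v∈f = ∈-subset⁻ (λ e → incident? e v) f∈ in
          decidable-stable (f ≟ e) λ f≢e → nonadjacent f∈M e∈M (f≢e , v , v∈f , v∈e)
    in trans (unique⇒∣p∣≡1 (∈-subset⁺ (λ e → incident? e v) (e∈M , v∈e)) unique)
             (cong [_] (sym ([]=⇒lookup v∈H)))
  ... | no v∉H = trans
    (Empty⇒∣p∣≡0 λ (e , e∈) → let e∈M , v∈e = ∈-subset⁻ (λ e → incident? e v) e∈ in
      v∉H (closed H (inSubgraph e∈M) v∈e))
    (cong [_] (sym (∉⇒outside v∉H)))

-- Parity of the order of a cubic graph.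

handshake : (G : Graph) → sum (degree G) ≡ size G * 2
handshake G = trans (double-counting (λ v e → v ∈? ends G e)) (sum-const λ e →
  trans (cong ∣_∣ (⊆-antisym (∈-subset⁻ (_∈? ends G e)) (∈-subset⁺ (_∈? ends G e))))
        (ends-card G e))

cubic⇒2∣order : (G : Graph) → Cubic G → 2 ∣ order G
-- With `3 n` split as `2 n + n`, divisibility by 2 of the sum and of its first summand passes to
-- `n`.
cubic⇒2∣order G cubic = ∣m+n∣m⇒∣n (subst (2 ∣_) 2*size≡2*n+n (m∣m*n (size G))) (m∣m*n (order G))
  where
  open ≡-Reasoning
  2*size≡2*n+n : 2 * size G ≡ 2 * order G + order G
  2*size≡2*n+n = begin
    2 * size G             ≡⟨ *-comm 2 (size G) ⟩
    size G * 2             ≡⟨ handshake G ⟨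
    sum (degree G)         ≡⟨ sum-const cubic ⟩
    order G * 3            ≡⟨ *-comm (order G) 3 ⟩
    order G + 2 * order G  ≡⟨ +-comm (order G) (2 * order G) ⟩
    2 * order G + order G  ∎

-- Counting in a matching of the complement of a vertex set.

module _ {G : Graph} {S : VertexSet G} {M : EdgeSet G}
         (matching : IsPerfectMatching (G -ᵥ S) M) where

  2*∣M∣+∣S∣≡order : 2 * ∣ M ∣ + ∣ S ∣ ≡ order G
  2*∣M∣+∣S∣≡order =
    trans (cong (_+ ∣ S ∣) (2*∣perfectMatching∣ matching)) (∣∁p∣+∣p∣≡n S)

  2∣∣S∣ : 2 ∣ order G → 2 ∣ ∣ S ∣
  2∣∣S∣ 2∣n = ∣m+n∣m⇒∣n (subst (2 ∣_) (sym 2*∣M∣+∣S∣≡order) 2∣n) (m∣m*n ∣ M ∣)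

  -- The formula for the size of a color class, doubled to avoid division: one copy of `∣ S ∣` joins
  -- `2 * ∣ M ∣` to make the order, the other remains.
  2*∣S++M∣≡order+∣S∣ : 2 * ∣ S ++ M ∣ ≡ order G + ∣ S ∣
  2*∣S++M∣≡order+∣S∣ = begin
    2 * ∣ S ++ M ∣              ≡⟨ cong (2 *_) (∣p++q∣≡∣p∣+∣q∣ S M) ⟩
    2 * (s + ∣ M ∣)             ≡⟨ cong (2 *_) (+-comm s ∣ M ∣) ⟩
    2 * (∣ M ∣ + s)             ≡⟨ *-distribˡ-+ 2 ∣ M ∣ s ⟩
    -- `2 * s` unfolds to `s + (s + 0)`; commuting the inner sum removes the zero.
    2 * ∣ M ∣ + 2 * s           ≡⟨ cong (λ t → 2 * ∣ M ∣ + (s + t)) (+-comm s 0) ⟩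
    2 * ∣ M ∣ + (s + s)         ≡⟨ +-assoc (2 * ∣ M ∣) s s ⟨
    2 * ∣ M ∣ + s + s           ≡⟨ cong (_+ s) 2*∣M∣+∣S∣≡order ⟩
    order G + s                 ∎
    where
    open ≡-Reasoning
    s = ∣ S ∣

  edge-avoids : ∀ {v e} → e ∈ M → Incident G v e → ¬ v ∈ S
  edge-avoids e∈M v∈e = x∈∁p⇒x∉p (closed (G -ᵥ S) (IsPerfectMatching.inSubgraph matching e∈M) v∈e)

-- From a total coloring to matchings.

module _ {G : Graph} {c : Assignment k G} (total : IsTotalColoring c) where
  open IsTotalColoring total

  vcolor-∈ : ∀ {i v} → v ∈ vertexClass c i → vcolor c v ≡ i
  vcolor-∈ {i} = ∈-subset⁻ (λ v → vcolor c v ≟ i)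

  ecolor-∈ : ∀ {i e} → e ∈ edgeClass c i → ecolor c e ≡ i
  ecolor-∈ {i} = ∈-subset⁻ (λ e → ecolor c e ≟ i)

  vertexClass-independent : ∀ i → Independent G (vertexClass c i)
  vertexClass-independent i u∈ v∈ adj =
    vertex-vertex adj (trans (vcolor-∈ u∈) (sym (vcolor-∈ v∈)))

  ecolor-injectiveAt : ∀ {v e f} → Incident G v e → Incident G v f →
                       ecolor c e ≡ ecolor c f → e ≡ f
  ecolor-injectiveAt {v} {e} {f} v∈e v∈f eq =
    decidable-stable (e ≟ f) λ e≢f → edge-edge (e≢f , v , v∈e , v∈f) eq

  -- The edges at `v` have distinct colors, and these avoid the two different colors `vcolor c v`
  -- and `i`.
  missing-color⇒degree≤ : ∀ {v i} → vcolor c v ≢ i →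
    (∀ e → Incident G v e → ecolor c e ≢ i) → 2 + degree G v ≤ k
  missing-color⇒degree≤ {v} {i} cv≢i missing =
    <-≤-trans
      -- Each of the two removals from `⊤` lowers the cardinality; `cv≢i` ensures that `i` is still
      -- present after the first.
      (≤-<-trans (≤-<-trans degree≤ (x∈p⇒∣p-x∣<∣p∣ (x∈p∧x≢y⇒x∈p-y ∈⊤ (cv≢i ∘ sym))))
                 (x∈p⇒∣p-x∣<∣p∣ {x = vcolor c v} ∈⊤))
      (≤-reflexive (∣⊤∣≡n k))
    where
    at : ∀ {e} → e ∈ subset (λ e → v ∈? ends G e) → Incident G v e
    at = ∈-subset⁻ (λ e → v ∈? ends G e)

    degree≤ : degree G v ≤ ∣ ⊤ - vcolor c v - i ∣
    degree≤ = injectiveOn⇒∣p∣≤∣q∣ _ _ (ecolor c)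
      (λ e∈ → x∈p∧x≢y⇒x∈p-y (x∈p∧x≢y⇒x∈p-y ∈⊤ (vertex-edge (at e∈) ∘ sym)) (missing _ (at e∈)))
      (λ e∈ f∈ → ecolor-injectiveAt (at e∈) (at f∈))

  -- The bound on `k` leaves no room for a color absent from both a vertex and its edges.
  -- Independence of edges within a class, and their avoidance of its vertices, come from properness
  -- alone.
  edgeClass-perfectMatching : (∀ v → k ≤ suc (degree G v)) →
    ∀ i → IsPerfectMatching (G -ᵥ vertexClass c i) (edgeClass c i)
  edgeClass-perfectMatching k≤ i = record
    { inSubgraph  = λ {e} e∈ → ∈-subset⁺ (λ f → ends G f ⊆? ∁ (vertexClass c i))
        λ v∈e → x∉p⇒x∈∁p λ v∈S →
          vertex-edge v∈e (trans (vcolor-∈ v∈S) (sym (ecolor-∈ e∈)))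
    ; nonadjacent = λ e∈ f∈ adj → edge-edge adj (trans (ecolor-∈ e∈) (sym (ecolor-∈ f∈)))
    ; saturates   = saturates
    }
    where
    saturates : ∀ {v} → v ∈ ∁ (vertexClass c i) → ∃[ e ] (e ∈ edgeClass c i × Incident G v e)
    saturates {v} v∈ with any? (λ e → (e ∈? edgeClass c i) ×-dec (v ∈? ends G e))
    ... | yes found = found
    -- Color `i` would be missing at `v`, giving `2 + degree G v ≤ k` against `k≤ v`.
    ... | no  none  = contradiction
      (missing-color⇒degree≤
        (λ cv≡i → x∈∁p⇒x∉p v∈ (∈-subset⁺ (λ u → vcolor c u ≟ i) cv≡i))
        (λ e v∈e ce≡i → none (e , ∈-subset⁺ (λ f → ecolor c f ≟ i) ce≡i , v∈e)))
      (≤⇒≯ (k≤ v))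

-- From partitions and matchings to a total coloring.

module _ {G : Graph} {S : Fin k → VertexSet G} {M : Fin k → EdgeSet G}
         (S-partition : IsPartition S) (M-partition : IsPartition M) where

  private
    module 𝒮 = IsPartition S-partition
    module ℳ = IsPartition M-partition

  -- The color of an element is the index of the part that `covers` provides; uniqueness of that
  -- part makes the choice agree with every membership.
  assignment : ∃[ c ] Assigns {k} {G} c S M
  assignment = record { vcolor = proj₁ ∘ 𝒮.covers ; ecolor = proj₁ ∘ ℳ.covers } , record
    { onVertices = λ {_} {v} → part-unique S-partition (proj₂ (𝒮.covers v))
    ; onEdges    = λ {_} {e} → part-unique M-partition (proj₂ (ℳ.covers e))
    }

  module _ {c : Assignment k G} (assigns : Assigns c S M) where
    open Assigns assigns

    -- `Assigns` leads only from membership to color. For the way back, `v` lies in some part, whose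
    -- index must then be its color.
    ∈-S-vcolor : ∀ v → v ∈ S (vcolor c v)
    ∈-S-vcolor v = let i , v∈Sᵢ = 𝒮.covers v in
      subst (λ j → v ∈ S j) (sym (onVertices v∈Sᵢ)) v∈Sᵢ

    ∈-M-ecolor : ∀ e → e ∈ M (ecolor c e)
    ∈-M-ecolor e = let i , e∈Mᵢ = ℳ.covers e in
      subst (λ j → e ∈ M j) (sym (onEdges e∈Mᵢ)) e∈Mᵢ

    -- Equal colors place both elements in classes of one index, which contradicts independence,
    -- nonadjacency in the matching, or `edge-avoids`.
    assigns⇒total : (∀ i → Independent G (S i)) →
                    (∀ i → IsPerfectMatching (G -ᵥ S i) (M i)) → IsTotalColoring c
    assigns⇒total independent matching = record
      { vertex-vertex = λ {u} {v} adj eq →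
          independent _ (subst (λ i → u ∈ S i) eq (∈-S-vcolor u)) (∈-S-vcolor v) adj
      ; edge-edge = λ {e} {f} adj eq →
          IsPerfectMatching.nonadjacent (matching _)
            (subst (λ i → e ∈ M i) eq (∈-M-ecolor e)) (∈-M-ecolor f) adj
      ; vertex-edge = λ {v} {e} v∈e eq →
          edge-avoids (matching _) (∈-M-ecolor e) v∈e (subst (λ i → v ∈ S i) eq (∈-S-vcolor v))
      }

lemma3p1 : (G : Graph) → Cubic G →
    ((c : Assignment 4 G) → IsTotalColoring c →
    (IsPartition (vertexClass c) × (∀ i → Independent G (vertexClass c i)))
    × (∀ i → IsPerfectMatching (G -ᵥ vertexClass c i) (edgeClass c i))
    × IsPartition (edgeClass c)
    × (∀ i → (2 ∣ ∣ vertexClass c i ∣)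
    × (2 * ∣ colorClass c i ∣ ≡ order G + ∣ vertexClass c i ∣)))
    ×
    ((S : Fin 4 → VertexSet G) (M : Fin 4 → EdgeSet G) →
    IsPartition S → (∀ i → Independent G (S i)) →
    IsPartition M → (∀ i → IsPerfectMatching (G -ᵥ S i) (M i)) →
    (∃[ c ] Assigns {4} {G} c S M)
    × (∀ (c : Assignment 4 G) → Assigns c S M → IsTotalColoring c))
lemma3p1 G cubic =
  (λ c total →
    -- For a cubic graph `suc (degree G v)` is exactly 4, the number of colors.
    let matching = edgeClass-perfectMatching total λ v → ≤-reflexive (cong suc (sym (cubic v))) in
    (fibres-partition (vcolor c) , vertexClass-independent total)
    , matching
    , fibres-partition (ecolor c)
    , λ i → 2∣∣S∣ (matching i) (cubic⇒2∣order G cubic) , 2*∣S++M∣≡order+∣S∣ (matching i))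
  , λ S M S-partition independent M-partition matching →
    assignment S-partition M-partition
    , λ c assigns → assigns⇒total S-partition M-partition assigns independent matching
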